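{- Let $\mathbb K=K\langle\!\langle x_1,\dots,x_m\rangle\!\rangle$ be a field of iterated Laurent series over a field $K$ of characteristic $0$, let $\lambda$ be one of the variables $x_1,\dots,x_m$, and let $L\subset\mathbb K$ be the subfield of series not involving $\lambda$. Let $$F(\lambda)=\frac{P(\lambda)}{\prod_{1\le i\le n}(\lambda^{j_i}-z_i)},$$ where $P(\lambda)\in L[\lambda]$, the $j_i$ are nonnegative integers, $z_i\in L$ (with $z_i=0$ allowed), and all $\lambda^{j_i}-z_i\ne0$. Suppose that the factors $\lambda^{j_i}-z_i$ of the denominator are pairwise relatively prime in $L[\lambda]$ and that the partial fraction decomposition of $F$ is $$F=f(\lambda)+\sum_{1\le i\le n}\frac{p_i(\lambda)}{\lambda^{j_i}-z_i},$$ where $f(\lambda)\in L[\lambda]$ and each $p_i(\lambda)\in L[\lambda]$ has degree less than $j_i$. Then $$\mathop{\mathrm{PT}}_\lambda F=f(\lambda)+\sum_{i:\ z_i\prec\lambda^{j_i}}\frac{p_i(\lambda)}{\lambda^{j_i}-z_i}.$$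
   Context: $K\langle\!\langle x_1,\dots,x_m\rangle\!\rangle=K((x_1))((x_2))\cdots((x_m))$; its elements are exactly the formal series $\sum_{\mathbf n\in\mathbb{Z}^m}b_{\mathbf n}\mathbf x^{\mathbf n}$ over $K$ with support well-ordered in the reverse lexicographic ordering of $\mathbb{Z}^m$ ($\mathbf n<\mathbf k$ iff for some $i$, $n_i<k_i$ and $n_j=k_j$ for all $j>i$). The order of a nonzero element is the minimum of its support; $a\prec b$ means that the order of $a$ is smaller than the order of $b$, and $0$ is regarded as having order $+\infty$ (so $\lambda^j\prec0$ and never $0\prec\lambda^{j}$). $\mathrm{PT}_\lambda F$ is the sum of the terms of (the series expansion in $\mathbb K$ of) $F$ with nonnegative exponent of $\lambda$. A polynomial of degree less than $0$ is $0$. -}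

module Defs where

open import Level using (Level; _⊔_)
open import Algebra.Bundles using (RawRing; CommutativeRing)
open import Algebra.Definitions using (Invertible)
import Algebra.Definitions.RawSemiring as RawSemiringDefinitions
open import Axiom.ExcludedMiddle using (ExcludedMiddle)
open import Data.Bool.Base using (Bool; if_then_else_)
open import Data.Fin.Base as Fin using (Fin; toℕ)
import Data.Fin.Properties as Fin
open import Data.Integer.Base as ℤ using (ℤ; +_; -[1+_]; 0ℤ; 1ℤ)
import Data.Integer.Properties as ℤ
open import Data.Nat.Base as ℕ using (ℕ; zero; suc; _∸_)
open import Data.Product.Base using (Σ-syntax; ∃-syntax; _×_; proj₁)
open import Data.Sum.Base using (_⊎_)
open import Data.Vec.Functional using (Vector; []; _∷_; head; tail)
open import Relation.Binary.PropositionalEquality.Core using (_≡_; _≢_; _≗_)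
open import Relation.Nullary using (¬_; Dec; yes; no; does)

------------------------------------------------------------------------
-- Fields of characteristic zero

module _ {c ℓ : Level} (R : CommutativeRing c ℓ) where
  open CommutativeRing R
  open RawSemiringDefinitions (RawRing.rawSemiring rawRing)
    using () renaming (_×_ to _·_)

  record IsField : Set (c ⊔ ℓ) where
    field
      1≉0    : ¬ (1# ≈ 0#)
      ≉0⇒inv : ∀ a → ¬ (a ≈ 0#) → Invertible _≈_ 1# _*_ a

  CharacteristicZero : Set ℓ
  CharacteristicZero = ∀ n → ¬ (suc n · 1# ≈ 0#)

------------------------------------------------------------------------
-- The ring R((x))

-- The pair (low , coeff) stands for the series Σₖ coeff k · x^(low + k).
-- coeff 0 may vanish, so a series has many representations; _≈_ compares
-- the coefficients of each power of x.

record Series {c : Level} (A : Set c) : Set c where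
  constructor series
  field
    low   : ℤ
    coeff : ℕ → A

open Series

mapSeries : ∀ {c} {A : Set c} → (ℤ → A → A) → Series A → Series A
mapSeries g a = series (low a) (λ k → g (low a ℤ.+ + k) (coeff a k))

module _ {c ℓ : Level} (R : RawRing c ℓ) where
  private module R = RawRing R
  open RawSemiringDefinitions R.rawSemiring using (sum)

  atℤ : (ℕ → R.Carrier) → ℤ → R.Carrier
  atℤ f (+ k)    = f k
  atℤ f -[1+ _ ] = R.0#

  -- the coefficient of x^e
  at : Series R.Carrier → ℤ → R.Carrier
  at a e = atℤ (coeff a) (e ℤ.- low a)

  power : R.Carrier → ℤ → Series R.Carrier
  power r e = series e λ { zero → r ; (suc _) → R.0# }

  laurent : RawRing c ℓ
  laurent = record
    { Carrier = Series R.Carrier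
    ; _≈_     = λ a b → ∀ e → at a e R.≈ at b e
    ; _+_     = λ a b → let l = low a ℤ.⊓ low b in
                  series l λ k → at a (l ℤ.+ + k) R.+ at b (l ℤ.+ + k)
    ; _*_     = λ a b → series (low a ℤ.+ low b) λ k →
                  sum {suc k} λ i → coeff a (toℕ i) R.* coeff b (k ∸ toℕ i)
    ; -_      = λ a → series (low a) λ k → R.- coeff a k
    ; 0#      = power R.0# 0ℤ
    ; 1#      = power R.1# 0ℤ
    }

------------------------------------------------------------------------
-- The ring R((x₁))((x₂))⋯((xₘ))

-- Index zero is x₁, the innermost variable.

iterated : ∀ {c ℓ} → RawRing c ℓ → ℕ → RawRing c ℓ
iterated R zero    = R
iterated R (suc m) = iterated (laurent R) m

Exponent : ℕ → Set
Exponent m = Vector ℤ m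

-- the coefficient of x₁^n₁ ⋯ xₘ^nₘ
coefficient : ∀ {c ℓ} (R : RawRing c ℓ) m →
              RawRing.Carrier (iterated R m) → Exponent m → RawRing.Carrier R
coefficient R zero    a n = a
coefficient R (suc m) a n =
  at R (coefficient (laurent R) m a (tail n)) (head n)

-- r · x₁^n₁ ⋯ xₘ^nₘ
term : ∀ {c ℓ} (R : RawRing c ℓ) m →
       RawRing.Carrier R → Exponent m → RawRing.Carrier (iterated R m)
term R zero    r n = r
term R (suc m) r n = term (laurent R) m (power R r (head n)) (tail n)

-- Σₙ bₙ xⁿ ↦ Σₙ g n bₙ xⁿ, for g n preserving 0
mapTerms : ∀ {c ℓ} (R : RawRing c ℓ) m →
           (Exponent m → RawRing.Carrier R → RawRing.Carrier R) →
           RawRing.Carrier (iterated R m) → RawRing.Carrier (iterated R m)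
mapTerms R zero    g a = g [] a
mapTerms R (suc m) g a =
  mapTerms (laurent R) m (λ n → mapSeries (λ e → g (e ∷ n))) a

unit : ∀ {m} → Fin m → Exponent m
unit i j = if does (i Fin.≟ j) then 1ℤ else 0ℤ

-- the reverse lexicographic ordering
_<ʳ_ : ∀ {m} → Exponent m → Exponent m → Set
n <ʳ k = ∃[ i ] (n i ℤ.< k i × (∀ j → i Fin.< j → n j ≡ k j))

_≤ʳ_ : ∀ {m} → Exponent m → Exponent m → Set
n ≤ʳ k = n <ʳ k ⊎ n ≗ k

-- v is the index of the distinguished variable λ.
module IteratedLaurent {c ℓ : Level} (K : RawRing c ℓ) (m : ℕ) (v : Fin m) where

  𝕂 : RawRing c ℓ
  𝕂 = iterated K m

  open RawRing 𝕂 public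
  open RawSemiringDefinitions rawSemiring public using (sum; product; _^_)

  private
    module K = RawRing K

    infix 9 _!_
    _!_ : Carrier → Exponent m → K.Carrier
    _!_ = coefficient K m

  infixl 6 _-_
  _-_ : Carrier → Carrier → Carrier
  a - b = a + (- b)

  x : Fin m → Carrier
  x i = term K m K.1# (unit i)

  Λ : Carrier
  Λ = x v

  IsOrder : Carrier → Exponent m → Set ℓ
  IsOrder a n = ¬ (a ! n K.≈ K.0#) × (∀ k → ¬ (a ! k K.≈ K.0#) → n ≤ʳ k)

  infix 4 _≺_
  _≺_ : Carrier → Carrier → Set ℓ
  a ≺ b = ∃[ n ] (IsOrder a n × (b ≈ 0# ⊎ ∃[ k ] (IsOrder b k × n <ʳ k)))

  PT : Carrier → Carrier
  PT = mapTerms K m λ n r → if does (0ℤ ℤ.≤? n v) then r else K.0#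

  InL : Carrier → Set ℓ
  InL a = ∀ n → n v ≢ 0ℤ → a ! n K.≈ K.0#

  -- the elements of L[λ] of degree less than d; only 0 for d = 0
  InL[Λ]<_ : ℕ → Carrier → Set (c ⊔ ℓ)
  (InL[Λ]< d) a = Σ[ q ∈ Vector Carrier d ]
    ((∀ i → InL (q i)) × a ≈ sum (λ i → q i * Λ ^ toℕ i))

  InL[Λ] : Carrier → Set (c ⊔ ℓ)
  InL[Λ] a = ∃[ d ] (InL[Λ]< d) a

  -- divisibility and coprimality inside the ring L[λ], not in the field 𝕂
  _∣L[Λ]_ : Carrier → Carrier → Set (c ⊔ ℓ)
  a ∣L[Λ] b = Σ[ q ∈ Carrier ] (InL[Λ] q × q * a ≈ b)

  CoprimeL[Λ] : Carrier → Carrier → Set (c ⊔ ℓ)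
  CoprimeL[Λ] a b = ∀ d → InL[Λ] d → d ∣L[Λ] a → d ∣L[Λ] b → d ∣L[Λ] 1#

  module Classical (em : ∀ {a} → ExcludedMiddle a) where

    -- Made total by 0⁻¹ = 0: over a field K, 𝕂 is a field, so the second
    -- clause applies to 0 alone.
    infix 8 _⁻¹
    _⁻¹ : Carrier → Carrier
    a ⁻¹ with em {P = Invertible _≈_ 1# _*_ a}
    ... | yes inv = proj₁ inv
    ... | no  _   = 0#

    infixl 7 _/_
    _/_ : Carrier → Carrier → Carrier
    a / b = a * b ⁻¹

    -- the sum of the f i over those i for which P i holds
    sumOver : ∀ {p n} → (Fin n → Set p) → Vector Carrier n → Carrier
    sumOver P f = sum λ i → if does (em {P = P i}) then f i else 0#

{-# OPTIONS --safe #-}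
-- Put D = λʲ - z and let u be its inverse.  The order of D is that of z if
-- z ≺ λʲ and that of λʲ otherwise.  If u had exponents e < 0 of λ in the first
-- case, or e > -j in the second, then the product of D with that part of u
-- would have a leading exponent which neither the product of D with the
-- rest of u nor the series D u = 1 contains.  Hence p u, with deg p < j, is
-- its own PT in the first case and has zero PT in the second.  No associativity
-- of the product in 𝕂 enters.
module Submission where

open import Defs
open import Algebra.Bundles using (RawRing; CommutativeMonoid; CommutativeRing; Group)
open import Algebra.Definitions using (Invertible)
import Algebra.Properties.CommutativeMonoid.Sum as Sum
import Algebra.Properties.Group as GroupProperties
import Algebra.Properties.Ring as RingProperties
open import Algebra.Structures using (IsNonAssociativeRing)
open import Axiom.ExcludedMiddle using (ExcludedMiddle)
open import Data.Bool.Base using (if_then_else_)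
open import Data.Empty using (⊥-elim)
open import Data.Fin.Base as Fin using (Fin; zero; suc; toℕ; fromℕ<; punchIn)
import Data.Fin.Properties as Fin
open import Data.Integer.Base as ℤ using (ℤ; +_; -[1+_]; 0ℤ; 1ℤ)
import Data.Integer.Properties as ℤ
open import Data.Integer.Tactic.RingSolver using (solve-∀)
open import Data.Nat.Base as ℕ using (ℕ; zero; suc; _∸_)
import Data.Nat.Properties as ℕ
open import Data.Product.Base using (∃-syntax; _×_; _,_; proj₁; proj₂)
open import Data.Sum.Base using (_⊎_; inj₁; inj₂; [_,_]′)
open import Data.Vec.Functional using ([]; _∷_; head; tail)
open import Function.Base using (_∘_)
open import Level using (Level; _⊔_; 0ℓ)
open import Relation.Binary.Definitions using (tri<; tri≈; tri>)
open import Relation.Binary.PropositionalEquality as ≡ using (_≡_; _≢_; _≗_)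
import Relation.Binary.Reasoning.Setoid as ≈-Reasoning
open import Relation.Nullary using (¬_; Dec; yes; no; does; ¬?)
open import Relation.Unary using (Pred; Decidable; ∁; U; _⊆_)

open Series

-- The expansion of 1/D as a geometric series is never formed; a comparison of supports replaces it.
-- For j > 0 the exponents of λ in D lie between 0 and j, and the order of D sits at an end of this
-- interval: at 0 if z ≺ λʲ, at j otherwise. Hence the leading monomial of D takes the unwanted part
-- of u to exponents of λ that are negative in the first case and positive in the second, while no
-- monomial of D can take the rest of u there, and 1 has only the exponent 0. Writing out the
-- convolution over several variables is avoided. All that is used of it is that a coefficient of a
-- product, minus one chosen product of coefficients, lies in every additively closed class that
-- contains the other contributions.

private variable
  c ℓ q : Level
  m : ℕ

-- Integers

i+j-i≡j : ∀ i j → (i ℤ.+ j) ℤ.- i ≡ j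
i+j-i≡j = solve-∀

i+[j-i]≡j : ∀ i j → i ℤ.+ (j ℤ.- i) ≡ j
i+[j-i]≡j = solve-∀

i+j+k≡i+k+j : ∀ i j k → i ℤ.+ j ℤ.+ k ≡ i ℤ.+ k ℤ.+ j
i+j+k≡i+k+j = solve-∀

i<j+k⇒i-j<k : ∀ {i} j {k} → i ℤ.< j ℤ.+ k → i ℤ.- j ℤ.< k
i<j+k⇒i-j<k {i} j {k} lt = ≡.subst (i ℤ.- j ℤ.<_) (i+j-i≡j j k) (ℤ.+-monoˡ-< (ℤ.- j) lt)

+ℤ-cancelˡ-< : ∀ i {j k} → i ℤ.+ j ℤ.< i ℤ.+ k → j ℤ.< k
+ℤ-cancelˡ-< i {j} {k} lt = ≡.subst (ℤ._< k) (i+j-i≡j i j) (i<j+k⇒i-j<k i lt)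

+ℤ-cancelˡ : ∀ i {j k} → i ℤ.+ j ≡ i ℤ.+ k → j ≡ k
+ℤ-cancelˡ i {j} {k} eq =
  ≡.trans (≡.sym (i+j-i≡j i j)) (≡.trans (≡.cong (ℤ._- i) eq) (i+j-i≡j i k))

-- Mirrors the clauses of `atℤ`: `below` the `low` of a series a coefficient is 0 by convention, at
-- an `offset` it is stored. Matching turns `e` into `l + k`, so that the subtraction in `at`
-- cancels.
data Position (l : ℤ) : ℤ → Set where
  below  : ∀ {e} → e ℤ.< l → Position l e
  offset : ∀ k → Position l (l ℤ.+ + k)

position : ∀ l e → Position l e
position l e with e ℤ.- l in eq
... | + k      = ≡.subst (Position l) (≡.trans (≡.cong (λ i → l ℤ.+ i) (≡.sym eq)) (i+[j-i]≡j l e)) (offset k)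
... | -[1+ k ] = below (ℤ.≰⇒> λ l≤e → negative (≡.subst (0ℤ ℤ.≤_) eq (ℤ.i≤j⇒0≤j-i l≤e)))
  where
  negative : ¬ (0ℤ ℤ.≤ -[1+ k ])
  negative ()

≤⇒offset : ∀ {l e} → l ℤ.≤ e → ∃[ k ] l ℤ.+ + k ≡ e
≤⇒offset {l} {e} l≤e with position l e
... | below e<l = ⊥-elim (ℤ.<⇒≱ e<l l≤e)
... | offset k  = k , ≡.refl

-- Supplies lengths of windows: if the second factor has no exponent below `m`, indices from `l + k`
-- on contribute nothing to the coefficient at `e`.
exceeds : ∀ l e m → ∃[ k ] e ℤ.< l ℤ.+ + k ℤ.+ m
exceeds l e m with position (l ℤ.+ m) e
... | below e<lm = 0 , ≡.subst (e ℤ.<_) (≡.cong (ℤ._+ m) (≡.sym (ℤ.+-identityʳ l))) e<lm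
... | offset k   = suc k , ≡.subst (l ℤ.+ m ℤ.+ + k ℤ.<_) (i+j+k≡i+k+j l m (+ suc k))
                             (ℤ.+-monoʳ-< (l ℤ.+ m) (ℤ.+<+ (ℕ.n<1+n k)))

-- One variable

module _ (R : RawRing c ℓ) where
  open RawRing R

  NonAssociative : Set (c ⊔ ℓ)
  NonAssociative = IsNonAssociativeRing _≈_ _+_ _*_ -_ 0# 1#

  -- Replaces the predicate _≈ 0# in the induction on the number of variables:
  -- the step from R to R((x)) replaces Q by "the coefficient of xᵉ is in Q".
  record SumClosed (Q : Pred Carrier q) : Set (c ⊔ ℓ ⊔ q) where
    field
      resp  : ∀ {a b} → a ≈ b → Q a → Q b
      zero∈ : Q 0#
      plus∈ : ∀ {a b} → Q a → Q b → Q (a + b)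

-- Finite sums and additively closed classes

module Sums (R : RawRing c ℓ) (isR : NonAssociative R) where
  open RawRing R
  open IsNonAssociativeRing isR hiding (zero)

  +-commutativeMonoid : CommutativeMonoid c ℓ
  +-commutativeMonoid = record { isCommutativeMonoid = +-isCommutativeMonoid }

  open Sum +-commutativeMonoid
  open ≈-Reasoning setoid

  sum-zero : ∀ {n} (f : Fin n → Carrier) → (∀ k → f k ≈ 0#) → sum f ≈ 0#
  sum-zero {n} f f≈0 = trans (sum-cong-≋ f≈0) (sum-replicate-zero n)

  sum-prefix : ∀ (f : ℕ → Carrier) {k n} → k ℕ.≤ n → (∀ i → k ℕ.≤ i → f i ≈ 0#) →
               sum {n} (f ∘ toℕ) ≈ sum {k} (f ∘ toℕ)
  sum-prefix f {n = n} ℕ.z≤n f≈0 = sum-zero {n} (λ i → f (toℕ i)) (λ i → f≈0 (toℕ i) ℕ.z≤n)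
  sum-prefix f (ℕ.s≤s k≤n) f≈0 =
    +-congˡ (sum-prefix (f ∘ suc) k≤n (λ i k≤i → f≈0 (suc i) (ℕ.s≤s k≤i)))

  ≈0-closed : SumClosed R (_≈ 0#)
  ≈0-closed = record
    { resp = λ a≈b a≈0 → trans (sym a≈b) a≈0
    ; zero∈ = refl
    ; plus∈ = λ a≈0 b≈0 → trans (+-cong a≈0 b≈0) (+-identityˡ 0#)
    }

  x-y≈0⇒x≈y : ∀ {x y} → x + - y ≈ 0# → x ≈ y
  x-y≈0⇒x≈y {x} {y} eq = begin
    x              ≈⟨ +-identityʳ x ⟨
    x + 0#         ≈⟨ +-congˡ (-‿inverseˡ y) ⟨
    x + (- y + y)  ≈⟨ +-assoc _ _ _ ⟨
    x + - y + y    ≈⟨ +-congʳ eq ⟩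
    0# + y         ≈⟨ +-identityˡ y ⟩
    y              ∎

  module _ {Q : Pred Carrier q} (Q-closed : SumClosed R Q) where
    open SumClosed Q-closed

    sum∈ : ∀ {n} (f : Fin n → Carrier) → (∀ k → Q (f k)) → Q (sum f)
    sum∈ {zero}  f f∈ = zero∈
    sum∈ {suc n} f f∈ = plus∈ (f∈ zero) (sum∈ (f ∘ suc) (f∈ ∘ suc))

    -- The difference is the sum over the indices `punchIn i k`, so closure under addition suffices:
    -- `Q` may fail to contain `f i` or negatives.
    sum-remove∈ : ∀ {n} (f : Fin n → Carrier) i → (∀ k → k ≢ i → Q (f k)) → Q (sum f + - f i)
    sum-remove∈ {suc n} f i others = resp (sym rest) (sum∈ _ (λ k → others _ (Fin.punchInᵢ≢i i k)))
      where
      rest : sum f + - f i ≈ sum (f ∘ punchIn i)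
      rest = begin
        sum f + - f i                      ≈⟨ +-congʳ (sum-remove {i = i} f) ⟩
        f i + sum (f ∘ punchIn i) + - f i  ≈⟨ +-congʳ (+-comm _ _) ⟩
        sum (f ∘ punchIn i) + f i + - f i  ≈⟨ +-assoc _ _ _ ⟩
        sum (f ∘ punchIn i) + (f i + - f i) ≈⟨ +-congˡ (-‿inverseʳ _) ⟩
        sum (f ∘ punchIn i) + 0#           ≈⟨ +-identityʳ _ ⟩
        sum (f ∘ punchIn i)                ∎

-- Coefficients and products in `R((x))`

module Laurent (R : RawRing c ℓ) (isR : NonAssociative R) where
  open RawRing R
  open IsNonAssociativeRing isR public hiding (zero)
  open Sums R isR

  private
    module L = RawRing (laurent R)

    +-group : Group c ℓ
    +-group = record { isGroup = +-isGroup }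

  open Sum +-commutativeMonoid
  open GroupProperties +-group using () renaming (ε⁻¹≈ε to -0≈0)
  open ≈-Reasoning setoid

  _[_] : Series Carrier → ℤ → Carrier
  _[_] = at R

  at-below : ∀ s {e} → e ℤ.< low s → s [ e ] ≡ 0#
  at-below s {e} e<l with e ℤ.- low s in eq
  ... | + _      = ⊥-elim (ℤ.<⇒≱ e<l (ℤ.0≤i-j⇒j≤i (≡.subst (0ℤ ℤ.≤_) (≡.sym eq) (ℤ.+≤+ ℕ.z≤n))))
  ... | -[1+ _ ] = ≡.refl

  at-offset : ∀ s k → s [ low s ℤ.+ + k ] ≡ coeff s k
  at-offset s k = ≡.cong (atℤ R (coeff s)) (i+j-i≡j (low s) (+ k))

  at-series : ∀ l (h : ℤ → Carrier) → (∀ e → e ℤ.< l → h e ≈ 0#) →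
              ∀ e → series l (λ k → h (l ℤ.+ + k)) [ e ] ≈ h e
  at-series l h h≈0 e with position l e
  ... | below e<l = trans (reflexive (at-below _ e<l)) (sym (h≈0 e e<l))
  ... | offset k  = reflexive (at-offset (series l _) k)

  at-+ : ∀ s t e → (s L.+ t) [ e ] ≈ s [ e ] + t [ e ]
  at-+ s t = at-series (low s ℤ.⊓ low t) (λ e → s [ e ] + t [ e ]) λ e e<l →
    trans (+-cong (reflexive (at-below s (ℤ.<-≤-trans e<l (ℤ.i⊓j≤i (low s) (low t)))))
                  (reflexive (at-below t (ℤ.<-≤-trans e<l (ℤ.i⊓j≤j (low s) (low t))))))
          (+-identityˡ 0#)

  at-mapSeries : ∀ (g : ℤ → Carrier → Carrier) → (∀ e → g e 0# ≈ 0#) → ∀ s e →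
                 mapSeries g s [ e ] ≈ g e (s [ e ])
  at-mapSeries g g0 s e with position (low s) e
  ... | below e<l = trans (reflexive (at-below (mapSeries g s) e<l))
                          (sym (trans (reflexive (≡.cong (g e) (at-below s e<l))) (g0 e)))
  ... | offset k  = reflexive (≡.trans (at-offset (mapSeries g s) k)
                                       (≡.cong (g _) (≡.sym (at-offset s k))))

  at-neg : ∀ s e → (L.- s) [ e ] ≈ - (s [ e ])
  at-neg s = at-mapSeries (λ _ → -_) (λ _ → -0≈0) s

  at-power : ∀ r e → power R r e [ e ] ≈ r
  at-power r e = reflexive (≡.trans (≡.cong (power R r e [_]) (≡.sym (ℤ.+-identityʳ e)))
                                    (at-offset (power R r e) 0))

  at-power-≢ : ∀ r e {i} → i ≢ e → power R r e [ i ] ≈ 0#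
  at-power-≢ r e {i} i≢e with position e i
  ... | below i<e      = reflexive (at-below (power R r e) i<e)
  ... | offset zero    = ⊥-elim (i≢e (ℤ.+-identityʳ e))
  ... | offset (suc k) = reflexive (at-offset (power R r e) (suc k))

  at-0# : ∀ e → L.0# [ e ] ≈ 0#
  at-0# e with e ℤ.≟ 0ℤ
  ... | yes ≡.refl = at-power 0# 0ℤ
  ... | no  e≢0    = at-power-≢ 0# 0ℤ e≢0

  -- A window of indices may be chosen to suit several products at once, although
  -- the definition of each product starts its sum at the product's own low.
  window : ℤ → ℕ → (ℤ → Carrier) → Carrier
  window N n h = sum {n} (λ k → h (N ℤ.+ + toℕ k))

  convolve : Series Carrier → Series Carrier → ℤ → ℤ → Carrier
  convolve s t e i = s [ i ] * t [ e ℤ.- i ]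

  at-*-below : ∀ s t {e} → e ℤ.< low s ℤ.+ low t → (s L.* t) [ e ] ≈ 0#
  at-*-below s t e<l = reflexive (at-below (s L.* t) e<l)

  convolve-≥ : ∀ s t {e} i → e ℤ.< i ℤ.+ low t → convolve s t e i ≈ 0#
  convolve-≥ s t i lt = trans (*-congˡ (reflexive (at-below t (i<j+k⇒i-j<k i lt)))) (zeroʳ _)

  at-*-low : ∀ s t e n → e ℤ.< low s ℤ.+ + n ℤ.+ low t →
             (s L.* t) [ e ] ≈ window (low s) n (convolve s t e)
  at-*-low s t e n lt with position (low s ℤ.+ low t) e
  ... | below e<l = trans (at-*-below s t e<l) (sym (sum-zero {n} (λ q → convolve s t e (low s ℤ.+ + toℕ q)) λ q →
          convolve-≥ s t (low s ℤ.+ + toℕ q)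
            (ℤ.<-≤-trans e<l (ℤ.+-monoˡ-≤ (low t) (ℤ.i≤i+j (low s) (+ toℕ q))))))
  ... | offset k = begin
    (s L.* t) [ e′ ]
      ≡⟨ at-offset (s L.* t) k ⟩
    sum {suc k} (λ q → coeff s (toℕ q) * coeff t (k ∸ toℕ q))
      ≈⟨ sum-cong-≋ {suc k} (λ q → *-cong (reflexive (≡.sym (at-offset s (toℕ q))))
                                  (reflexive (≡.sym (second (toℕ q) (ℕ.≤-pred (Fin.toℕ<n q)))))) ⟩
    sum {suc k} (λ q → convolve s t e′ (low s ℤ.+ + toℕ q))
      -- The defining sum has `k + 1` terms; the further terms of the window pair `s` with
      -- coefficients of `t` below `low t`.
      ≈⟨ sum-prefix (λ q → convolve s t e′ (low s ℤ.+ + q)) k<n (λ i k<i → convolve-≥ s t (low s ℤ.+ + i)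
           (≡.subst (e′ ℤ.<_) (i+j+k≡i+k+j (low s) (low t) (+ i))
             (ℤ.+-monoʳ-< (low s ℤ.+ low t) (ℤ.+<+ k<i)))) ⟨
    window (low s) n (convolve s t e′) ∎
    where
    e′ = low s ℤ.+ low t ℤ.+ + k

    split : ∀ a b c d → (a ℤ.+ b ℤ.+ c) ℤ.- (a ℤ.+ d) ≡ b ℤ.+ (c ℤ.- d)
    split = solve-∀

    second : ∀ q → q ℕ.≤ k → t [ (low s ℤ.+ low t ℤ.+ + k) ℤ.- (low s ℤ.+ + q) ] ≡ coeff t (k ∸ q)
    second q q≤k = ≡.trans (≡.cong (t [_]) (≡.trans (split (low s) (low t) (+ k) (+ q))
      (≡.cong (λ i → low t ℤ.+ i) (≡.trans (ℤ.m-n≡m⊖n k q) (ℤ.⊖-≥ q≤k))))) (at-offset t (k ∸ q))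

    k<n : k ℕ.< n
    k<n = ℤ.drop‿+<+ (+ℤ-cancelˡ-< (low s ℤ.+ low t)
            (≡.subst (low s ℤ.+ low t ℤ.+ + k ℤ.<_) (i+j+k≡i+k+j (low s) (+ n) (low t)) lt))

  -- Moving the start of the window down by one prepends a term whose first factor lies below
  -- `low s`, hence a zero; the induction is on the gap between `N` and `low s`.
  at-* : ∀ s t e {N L} n → N ℤ.≤ low s → L ℤ.≤ low t → e ℤ.< N ℤ.+ + n ℤ.+ L →
         (s L.* t) [ e ] ≈ window N n (convolve s t e)
  at-* s t e {N} n N≤s L≤t lt = from-gap (proj₁ gap) N (proj₂ gap) n
      (ℤ.<-≤-trans lt (ℤ.+-monoʳ-≤ (N ℤ.+ + n) L≤t))
    where
    gap : ∃[ p ] N ℤ.+ + p ≡ low s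
    gap = ≤⇒offset N≤s

    shift : ∀ a b → a ℤ.+ (1ℤ ℤ.+ b) ≡ (a ℤ.+ 1ℤ) ℤ.+ b
    shift = solve-∀

    from-gap : ∀ p N → N ℤ.+ + p ≡ low s → ∀ n → e ℤ.< N ℤ.+ + n ℤ.+ low t →
          (s L.* t) [ e ] ≈ window N n (convolve s t e)
    from-gap zero N eq n lt with ≡.trans (≡.sym (ℤ.+-identityʳ N)) eq
    ... | ≡.refl = at-*-low s t e n lt
    -- An empty window leaves `e` below `low s + low t`, so both sides are 0.
    from-gap (suc p) N eq zero lt =
      at-*-below s t (ℤ.<-≤-trans lt (ℤ.+-monoˡ-≤ (low t) (≡.subst (N ℤ.+ 0ℤ ℤ.≤_) eq
        (ℤ.+-monoʳ-≤ N (ℤ.+≤+ ℕ.z≤n)))))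
    from-gap (suc p) N eq (suc n) lt = begin
      (s L.* t) [ e ]
        ≈⟨ from-gap p (N ℤ.+ 1ℤ) (≡.trans (≡.sym (shift N (+ p))) eq) n
             (≡.subst (λ i → e ℤ.< i ℤ.+ low t) (shift N (+ n)) lt) ⟩
      window (N ℤ.+ 1ℤ) n (convolve s t e)
        ≈⟨ sum-cong-≋ {n} (λ k → reflexive (≡.cong (convolve s t e) (shift N (+ toℕ k)))) ⟨
      sum {n} (λ k → convolve s t e (N ℤ.+ + suc (toℕ k)))
        ≈⟨ +-identityˡ _ ⟨
      0# + sum {n} (λ k → convolve s t e (N ℤ.+ + suc (toℕ k)))
        ≈⟨ +-congʳ (trans (*-congʳ (reflexive (at-below s N<s))) (zeroˡ _)) ⟨
      window N (suc n) (convolve s t e) ∎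
      where
      N<s : N ℤ.+ 0ℤ ℤ.< low s
      N<s = ≡.subst (N ℤ.+ 0ℤ ℤ.<_) eq (ℤ.+-monoʳ-< N (ℤ.+<+ (ℕ.s≤s ℕ.z≤n)))

  -- Equal series may have different `low`, which gives the two defining sums different ranges. The
  -- minima `N` and `M` allow a common window, on which the terms agree one by one.
  *-congL : ∀ {s s′ t t′} → s L.≈ s′ → t L.≈ t′ → (s L.* t) L.≈ (s′ L.* t′)
  *-congL {s} {s′} {t} {t′} s≈s′ t≈t′ e = begin
    (s L.* t) [ e ]
      ≈⟨ at-* s t e n (ℤ.i⊓j≤i _ _) (ℤ.i⊓j≤i _ _) e< ⟩
    window N n (convolve s t e)
      ≈⟨ sum-cong-≋ {n} (λ k → *-cong (s≈s′ (N ℤ.+ + toℕ k)) (t≈t′ (e ℤ.- (N ℤ.+ + toℕ k)))) ⟩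
    window N n (convolve s′ t′ e)
      ≈⟨ at-* s′ t′ e n (ℤ.i⊓j≤j (low s) _) (ℤ.i⊓j≤j (low t) _) e< ⟨
    (s′ L.* t′) [ e ] ∎
    where
    N = low s ℤ.⊓ low s′
    M = low t ℤ.⊓ low t′
    n = proj₁ (exceeds N e M)
    e< = proj₂ (exceeds N e M)

  distribˡL : ∀ s t u → (s L.* (t L.+ u)) L.≈ ((s L.* t) L.+ (s L.* u))
  distribˡL s t u e = begin
    (s L.* (t L.+ u)) [ e ]
      ≈⟨ at-* s (t L.+ u) e n ℤ.≤-refl ℤ.≤-refl e< ⟩
    window N n (convolve s (t L.+ u) e)
      ≈⟨ sum-cong-≋ {n} (λ k → trans (*-congˡ (at-+ t u (e ℤ.- (N ℤ.+ + toℕ k)))) (distribˡ _ _ _)) ⟩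
    sum {n} (λ k → convolve s t e (N ℤ.+ + toℕ k) + convolve s u e (N ℤ.+ + toℕ k))
      ≈⟨ ∑-distrib-+ {n} _ _ ⟩
    window N n (convolve s t e) + window N n (convolve s u e)
      ≈⟨ +-cong (at-* s t e n ℤ.≤-refl (ℤ.i⊓j≤i _ _) e<)
                (at-* s u e n ℤ.≤-refl (ℤ.i⊓j≤j (low t) _) e<) ⟨
    (s L.* t) [ e ] + (s L.* u) [ e ]
      ≈⟨ at-+ (s L.* t) (s L.* u) e ⟨
    ((s L.* t) L.+ (s L.* u)) [ e ] ∎
    where
    N = low s
    M = low t ℤ.⊓ low u
    n = proj₁ (exceeds N e M)
    e< = proj₂ (exceeds N e M)

  distribʳL : ∀ s t u → ((t L.+ u) L.* s) L.≈ ((t L.* s) L.+ (u L.* s))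
  distribʳL s t u e = begin
    ((t L.+ u) L.* s) [ e ]
      ≈⟨ at-* (t L.+ u) s e n ℤ.≤-refl ℤ.≤-refl e< ⟩
    window N n (convolve (t L.+ u) s e)
      ≈⟨ sum-cong-≋ {n} (λ k → trans (*-congʳ (at-+ t u (N ℤ.+ + toℕ k))) (distribʳ _ _ _)) ⟩
    sum {n} (λ k → convolve t s e (N ℤ.+ + toℕ k) + convolve u s e (N ℤ.+ + toℕ k))
      ≈⟨ ∑-distrib-+ {n} _ _ ⟩
    window N n (convolve t s e) + window N n (convolve u s e)
      ≈⟨ +-cong (at-* t s e n (ℤ.i⊓j≤i _ _) ℤ.≤-refl e<)
                (at-* u s e n (ℤ.i⊓j≤j (low t) _) ℤ.≤-refl e<) ⟨
    (t L.* s) [ e ] + (u L.* s) [ e ]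
      ≈⟨ at-+ (t L.* s) (u L.* s) e ⟨
    ((t L.* s) L.+ (u L.* s)) [ e ] ∎
    where
    N = low t ℤ.⊓ low u
    M = low s
    n = proj₁ (exceeds N e M)
    e< = proj₂ (exceeds N e M)

  module _ {Q : Pred Carrier q} (Q-closed : SumClosed R Q) where
    open SumClosed Q-closed

    -- The window starts no higher than `i`, and its length accounts for `j`, so the term at `i`
    -- occurs in it, as number `d`, even if `i` or `j` lies below the stored coefficients. Taking
    -- this term out leaves only pairs covered by the hypothesis.
    at-*∈ : ∀ s t i j →
            (∀ i′ j′ → i′ ℤ.+ j′ ≡ i ℤ.+ j → i′ ≢ i → Q (s [ i′ ] * t [ j′ ])) →
            Q ((s L.* t) [ i ℤ.+ j ] + - (s [ i ] * t [ j ]))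
    at-*∈ s t i j others =
      resp (+-cong (sym (at-* s t e n (ℤ.i⊓j≤i _ _) (ℤ.i⊓j≤i _ _) e<)) (-‿cong (reflexive (term-d d<n))))
        (sum-remove∈ Q-closed {n} (λ k → convolve s t e (N ℤ.+ + toℕ k)) (fromℕ< d<n) λ k k≢d →
          others (N ℤ.+ + toℕ k) (e ℤ.- (N ℤ.+ + toℕ k)) (i+[j-i]≡j (N ℤ.+ + toℕ k) e) λ N+k≡i →
            k≢d (Fin.toℕ-injective (≡.trans (ℤ.+-injective (+ℤ-cancelˡ N (≡.trans N+k≡i (≡.sym N+d≡i))))
                                            (≡.sym (Fin.toℕ-fromℕ< d<n)))))
      where
      e = i ℤ.+ j
      N = low s ℤ.⊓ i
      M = low t ℤ.⊓ j
      d = proj₁ (≤⇒offset (ℤ.i⊓j≤j (low s) i))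
      N+d≡i = proj₂ (≤⇒offset (ℤ.i⊓j≤j (low s) i))
      n = proj₁ (exceeds N e M)
      e< = proj₂ (exceeds N e M)

      d<n : d ℕ.< n
      d<n = ℤ.drop‿+<+ (+ℤ-cancelˡ-< N (≡.subst (ℤ._< N ℤ.+ + n) (≡.sym N+d≡i)
              (ℤ.≰⇒> λ n≤i → ℤ.<⇒≱ e< (ℤ.+-mono-≤ n≤i (ℤ.i⊓j≤j (low t) j)))))

      term-d : ∀ d<n → convolve s t e (N ℤ.+ + toℕ (fromℕ< {d} {n} d<n)) ≡ s [ i ] * t [ j ]
      term-d d<n = ≡.trans
        (≡.cong (convolve s t e) (≡.trans (≡.cong (λ k → N ℤ.+ + k) (Fin.toℕ-fromℕ< d<n)) N+d≡i))
        (≡.cong (λ k → s [ i ] * t [ k ]) (i+j-i≡j i j))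

    -- Adds back the term that `at-*∈` takes out, at the arbitrarily chosen pair `e`, `0ℤ`.
    at-*-closed : ∀ s t e → (∀ i j → i ℤ.+ j ≡ e → Q (s [ i ] * t [ j ])) → Q ((s L.* t) [ e ])
    at-*-closed s t e all = resp (reflexive (≡.cong ((s L.* t) [_]) (ℤ.+-identityʳ e)))
      (resp x-y+y≈x (plus∈ (at-*∈ s t e 0ℤ (λ i j eq _ → all i j (≡.trans eq (ℤ.+-identityʳ e))))
                    (all e 0ℤ (ℤ.+-identityʳ e))))
      where
      x-y+y≈x : ∀ {x y} → x + - y + y ≈ x
      x-y+y≈x = trans (+-assoc _ _ _) (trans (+-congˡ (-‿inverseˡ _)) (+-identityʳ _))

  at-closed : {Q : Pred Carrier q} → SumClosed R Q → ∀ e → SumClosed (laurent R) (λ s → Q (s [ e ]))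
  at-closed Q-closed e = record
    { resp  = λ s≈t → resp (s≈t e)
    ; zero∈ = resp (sym (at-0# e)) zero∈
    ; plus∈ = λ {s} {t} s∈ t∈ → resp (sym (at-+ s t e)) (plus∈ s∈ t∈)
    }
    where open SumClosed Q-closed

  *-identityˡL : ∀ s → (L.1# L.* s) L.≈ s
  *-identityˡL s e = begin
    (L.1# L.* s) [ e ]           ≡⟨ ≡.cong ((L.1# L.* s) [_]) (ℤ.+-identityˡ e) ⟨
    (L.1# L.* s) [ 0ℤ ℤ.+ e ]    ≈⟨ x-y≈0⇒x≈y (at-*∈ ≈0-closed L.1# s 0ℤ e λ i j _ i≢0 →
                                     trans (*-congʳ (at-power-≢ 1# 0ℤ i≢0)) (zeroˡ _)) ⟩
    L.1# [ 0ℤ ] * s [ e ]        ≈⟨ *-congʳ (at-power 1# 0ℤ) ⟩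
    1# * s [ e ]                 ≈⟨ *-identityˡ _ ⟩
    s [ e ]                      ∎

  *-identityʳL : ∀ s → (s L.* L.1#) L.≈ s
  *-identityʳL s e = begin
    (s L.* L.1#) [ e ]           ≡⟨ ≡.cong ((s L.* L.1#) [_]) (ℤ.+-identityʳ e) ⟨
    (s L.* L.1#) [ e ℤ.+ 0ℤ ]    ≈⟨ x-y≈0⇒x≈y (at-*∈ ≈0-closed s L.1# e 0ℤ λ i j eq i≢e →
                                     trans (*-congˡ (at-power-≢ 1# 0ℤ λ j≡0 → i≢e (right-zero eq j≡0))) (zeroʳ _)) ⟩
    s [ e ] * L.1# [ 0ℤ ]        ≈⟨ *-congˡ (at-power 1# 0ℤ) ⟩
    s [ e ] * 1#                 ≈⟨ *-identityʳ _ ⟩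
    s [ e ]                      ∎
    where
    right-zero : ∀ {i j} → i ℤ.+ j ≡ e ℤ.+ 0ℤ → j ≡ 0ℤ → i ≡ e
    right-zero {i} eq ≡.refl = ≡.trans (≡.sym (ℤ.+-identityʳ i)) (≡.trans eq (ℤ.+-identityʳ e))

  isNonAssociativeRing : NonAssociative (laurent R)
  isNonAssociativeRing = record
    { +-isAbelianGroup = record
      { isGroup = record
        { isMonoid = record
          { isSemigroup = record
            { isMagma = record
              { isEquivalence = record
                { refl = λ e → refl
                ; sym = λ s≈t e → sym (s≈t e)
                ; trans = λ s≈t t≈u e → trans (s≈t e) (t≈u e)
                }
              ; ∙-cong = λ {s} {s′} {t} {t′} s≈s′ t≈t′ e →
                  trans (at-+ s t e) (trans (+-cong (s≈s′ e) (t≈t′ e)) (sym (at-+ s′ t′ e)))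
              }
            ; assoc = λ s t u e → begin
                ((s L.+ t) L.+ u) [ e ]        ≈⟨ trans (at-+ (s L.+ t) u e) (+-congʳ (at-+ s t e)) ⟩
                s [ e ] + t [ e ] + u [ e ]    ≈⟨ +-assoc _ _ _ ⟩
                s [ e ] + (t [ e ] + u [ e ])  ≈⟨ trans (at-+ s (t L.+ u) e) (+-congˡ (at-+ t u e)) ⟨
                (s L.+ (t L.+ u)) [ e ]        ∎
            }
          ; identity = (λ s e → trans (at-+ L.0# s e) (trans (+-congʳ (at-0# e)) (+-identityˡ _)))
                     , (λ s e → trans (at-+ s L.0# e) (trans (+-congˡ (at-0# e)) (+-identityʳ _)))
          }
        ; inverse = (λ s e → trans (at-+ (L.- s) s e) (trans (+-congʳ (at-neg s e))
                               (trans (-‿inverseˡ _) (sym (at-0# e)))))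
                  , (λ s e → trans (at-+ s (L.- s) e) (trans (+-congˡ (at-neg s e))
                               (trans (-‿inverseʳ _) (sym (at-0# e)))))
        ; ⁻¹-cong = λ {s} {t} s≈t e → trans (at-neg s e) (trans (-‿cong (s≈t e)) (sym (at-neg t e)))
        }
      ; comm = λ s t e → trans (at-+ s t e) (trans (+-comm _ _) (sym (at-+ t s e)))
      }
    ; *-cong = λ {s} {s′} {t} {t′} → *-congL {s} {s′} {t} {t′}
    ; *-identity = *-identityˡL , *-identityʳL
    ; distrib = distribˡL , distribʳL
    ; zero = zeroˡL , zeroʳL
    }
    where
    zeroˡL : ∀ s → (L.0# L.* s) L.≈ L.0#
    zeroˡL s e = trans (at-*-closed ≈0-closed L.0# s e λ i j _ → trans (*-congʳ (at-0# i)) (zeroˡ _)) (sym (at-0# e))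

    zeroʳL : ∀ s → (s L.* L.0#) L.≈ L.0#
    zeroʳL s e = trans (at-*-closed ≈0-closed s L.0# e λ i j _ → trans (*-congˡ (at-0# j)) (zeroʳ _)) (sym (at-0# e))

-- Several variables

<ʳ-tail : {n k : Exponent (suc m)} → tail n <ʳ tail k → n <ʳ k
<ʳ-tail (i , lt , eq) = suc i , lt , λ { zero () ; (suc j) (ℕ.s≤s i<j) → eq j i<j }

<ʳ-head : {n k : Exponent (suc m)} → tail n ≗ tail k → head n ℤ.< head k → n <ʳ k
<ʳ-head eq lt = zero , lt , λ { zero () ; (suc j) _ → eq j }

≗-∷ : {n k : Exponent (suc m)} → head n ≡ head k → tail n ≗ tail k → n ≗ k
≗-∷ eq eqs zero    = eq
≗-∷ eq eqs (suc i) = eqs i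

compareʳ : (n k : Exponent m) → n <ʳ k ⊎ n ≗ k ⊎ k <ʳ n
compareʳ {zero}  n k = inj₂ (inj₁ λ ())
compareʳ {suc m} n k with compareʳ (tail n) (tail k)
... | inj₁ n<k        = inj₁ (<ʳ-tail n<k)
... | inj₂ (inj₂ k<n) = inj₂ (inj₂ (<ʳ-tail k<n))
... | inj₂ (inj₁ n≗k) with ℤ.<-cmp (head n) (head k)
...   | tri< n<k _ _ = inj₁ (<ʳ-head n≗k n<k)
...   | tri≈ _ n≡k _ = inj₂ (inj₁ (≗-∷ n≡k n≗k))
...   | tri> _ _ k<n = inj₂ (inj₂ (<ʳ-head (≡.sym ∘ n≗k) k<n))

<ʳ⇒≱ʳ : {n k : Exponent m} → n <ʳ k → ¬ (k ≤ʳ n)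
<ʳ⇒≱ʳ (i , lt , _) (inj₂ k≗n) = ℤ.<-irrefl (≡.sym (k≗n i)) lt
<ʳ⇒≱ʳ (i , lt , eq) (inj₁ (i′ , lt′ , eq′)) with Fin.<-cmp i i′
... | tri< i<i′ _ _   = ℤ.<-irrefl (≡.sym (eq i′ i<i′)) lt′
... | tri≈ _ ≡.refl _ = ℤ.<-asym lt lt′
... | tri> _ _ i′<i   = ℤ.<-irrefl (≡.sym (eq′ i i′<i)) lt

-- Of two strict comparisons, the one with the larger index decides: there the other one is an
-- equality or points the same way.
<ʳ-≤ʳ-trans : {n k l : Exponent m} → n <ʳ k → k ≤ʳ l → n <ʳ l
<ʳ-≤ʳ-trans {n = n} (i , lt , eq) (inj₂ k≗l) =
  i , ≡.subst (n i ℤ.<_) (k≗l i) lt , λ j i<j → ≡.trans (eq j i<j) (k≗l j)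
<ʳ-≤ʳ-trans {n = n} {l = l} (i , lt , eq) (inj₁ (i′ , lt′ , eq′)) with Fin.<-cmp i i′
... | tri< i<i′ _ _   = i′ , ≡.subst (ℤ._< l i′) (≡.sym (eq i′ i<i′)) lt′
                      , λ j i′<j → ≡.trans (eq j (ℕ.<-trans i<i′ i′<j)) (eq′ j i′<j)
... | tri≈ _ ≡.refl _ = i , ℤ.<-trans lt lt′ , λ j i<j → ≡.trans (eq j i<j) (eq′ j i<j)
... | tri> _ _ i′<i   = i , ≡.subst (n i ℤ.<_) (eq′ i i′<i) lt
                      , λ j i<j → ≡.trans (eq j i<j) (eq′ j (ℕ.<-trans i′<i i<j))

infixl 6 _⊕_
_⊕_ : Exponent m → Exponent m → Exponent m
(n ⊕ k) i = n i ℤ.+ k i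

-- The same index decides both comparisons: what `n′` gains over `n` there, `k′` must lose against
-- `k`, and beyond it the entries agree.
⊕-<ʳ : {n k n′ k′ : Exponent m} → n′ ⊕ k′ ≗ n ⊕ k → n <ʳ n′ → k′ <ʳ k
⊕-<ʳ {n = n} {k} {n′} {k′} sums (i , lt , eq) =
    i
  , ℤ.≰⇒> (λ k≤k′ → ℤ.<-irrefl (≡.sym (sums i)) (ℤ.+-mono-<-≤ lt k≤k′))
  , λ j i<j → +ℤ-cancelˡ (n j) (≡.trans (≡.cong (ℤ._+ k′ j) (eq j i<j)) (sums j))

-- Coefficients of iterated series

iterated-isNonAssociativeRing :
  {R : RawRing c ℓ} → NonAssociative R → ∀ m → NonAssociative (iterated R m)
iterated-isNonAssociativeRing isR zero    = isR
iterated-isNonAssociativeRing isR (suc m) =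
  iterated-isNonAssociativeRing (Laurent.isNonAssociativeRing _ isR) m

coefficient-cong : (R : RawRing c ℓ) → ∀ m {a b} → RawRing._≈_ (iterated R m) a b →
                   ∀ n → RawRing._≈_ R (coefficient R m a n) (coefficient R m b n)
coefficient-cong R zero    a≈b n = a≈b
coefficient-cong R (suc m) a≈b n = coefficient-cong (laurent R) m a≈b (tail n) (head n)

coefficient-ext : (R : RawRing c ℓ) → ∀ m {a b} →
                  (∀ n → RawRing._≈_ R (coefficient R m a n) (coefficient R m b n)) →
                  RawRing._≈_ (iterated R m) a b
coefficient-ext R zero    a≈b = a≈b []
coefficient-ext R (suc m) a≈b = coefficient-ext (laurent R) m λ n e → a≈b (e ∷ n)

≗-dec : (n k : Exponent m) → Dec (n ≗ k)
≗-dec n k = Fin.all? λ i → n i ℤ.≟ k i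

-- Exponents are functions and extensionality is not assumed, so `n ≗ k` cannot be turned into
-- `n ≡ k`; the entries are replaced one at a time, where `at` reads them.
coefficient-≗ : {R : RawRing c ℓ} → NonAssociative R → ∀ m a {n k} → n ≗ k →
                RawRing._≈_ R (coefficient R m a n) (coefficient R m a k)
coefficient-≗ isR zero    a n≗k = IsNonAssociativeRing.refl isR
coefficient-≗ {R = R} isR (suc m) a {n} {k} n≗k = trans
  (coefficient-≗ isNonAssociativeRing m a (n≗k ∘ suc) (head n))
  (reflexive (≡.cong (at R (coefficient (laurent R) m a (tail k))) (n≗k zero)))
  where
  open Laurent R isR

coefficient-0# : {R : RawRing c ℓ} → NonAssociative R → ∀ m n →
                 RawRing._≈_ R (coefficient R m (RawRing.0# (iterated R m)) n) (RawRing.0# R)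
coefficient-0# isR zero    n = IsNonAssociativeRing.refl isR
coefficient-0# {R = R} isR (suc m) n =
  trans (coefficient-0# isNonAssociativeRing m (tail n) (head n)) (at-0# (head n))
  where
  open Laurent R isR

coefficient-+ : {R : RawRing c ℓ} → NonAssociative R → ∀ m a b n →
                let open RawRing R; open RawRing (iterated R m) using () renaming (_+_ to _+′_) in
                coefficient R m (a +′ b) n ≈ coefficient R m a n + coefficient R m b n
coefficient-+ isR zero a b n = IsNonAssociativeRing.refl isR
coefficient-+ {R = R} isR (suc m) a b n =
  trans (coefficient-+ isNonAssociativeRing m a b (tail n) (head n))
        (at-+ (coefficient (laurent R) m a (tail n)) (coefficient (laurent R) m b (tail n)) (head n))
  where
  open Laurent R isR

coefficient-neg : {R : RawRing c ℓ} → NonAssociative R → ∀ m a n →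
                  let open RawRing R; open RawRing (iterated R m) using () renaming (-_ to -′_) in
                  coefficient R m (-′ a) n ≈ - coefficient R m a n
coefficient-neg isR zero a n = IsNonAssociativeRing.refl isR
coefficient-neg {R = R} isR (suc m) a n =
  trans (coefficient-neg isNonAssociativeRing m a (tail n) (head n))
        (at-neg (coefficient (laurent R) m a (tail n)) (head n))
  where
  open Laurent R isR

-- The error splits in two. `outer` collects the factorisations whose tails differ from the chosen
-- ones; it comes from the induction hypothesis over `laurent R`, for the class of series whose
-- coefficient at `i + j` is in `Q`. `inner` collects those with the chosen tails and other heads, a
-- matter of one variable.
coefficient-*∈ : {R : RawRing c ℓ} → NonAssociative R → ∀ m {Q : Pred (RawRing.Carrier R) q} →
  SumClosed R Q → ∀ a b n k →
  let open RawRing R; open RawRing (iterated R m) using () renaming (_*_ to _*′_) in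
  (∀ n′ k′ → n′ ⊕ k′ ≗ n ⊕ k → ¬ (n′ ≗ n) → Q (coefficient R m a n′ * coefficient R m b k′)) →
  Q (coefficient R m (a *′ b) (n ⊕ k) + - (coefficient R m a n * coefficient R m b k))
coefficient-*∈ {R = R} isR zero Q-closed a b n k others =
  SumClosed.resp Q-closed (sym (-‿inverseʳ (a * b))) (SumClosed.zero∈ Q-closed)
  where
  open RawRing R using (_*_)
  open IsNonAssociativeRing isR
coefficient-*∈ {R = R} isR (suc m) {Q} Q-closed a b n k others =
  resp telescope (plus∈ outer inner)
  where
  open RawRing R using (_*_; _+_; -_; Carrier; _≈_)
  open RawRing (iterated (laurent R) m) using () renaming (_*_ to _*′_)
  open RawRing (laurent R) using () renaming (_+_ to _+ˡ_; _*_ to _*ˡ_; -_ to -ˡ_)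
  open SumClosed Q-closed
  open Laurent R isR
  _!_ = coefficient (laurent R) m
  s = a ! tail n
  t = b ! tail k
  ab = (a *′ b) ! (tail n ⊕ tail k)
  i = head n
  j = head k

  outer : Q ((ab +ˡ (-ˡ (s *ˡ t))) [ i ℤ.+ j ])
  outer = coefficient-*∈ isNonAssociativeRing m (at-closed Q-closed (i ℤ.+ j)) a b (tail n) (tail k)
    λ n′ k′ sums n′≢n → at-*-closed Q-closed (a ! n′) (b ! k′) (i ℤ.+ j) λ i′ j′ i′+j′ →
      others (i′ ∷ n′) (j′ ∷ k′) (≗-∷ i′+j′ sums) λ n′≗n → n′≢n (n′≗n ∘ suc)

  inner : Q ((s *ˡ t) [ i ℤ.+ j ] + - (s [ i ] * t [ j ]))
  inner = at-*∈ Q-closed s t i j λ i′ j′ i′+j′ i′≢i →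
    others (i′ ∷ tail n) (j′ ∷ tail k) (≗-∷ i′+j′ λ _ → ≡.refl) λ n′≗n → i′≢i (n′≗n zero)

  telescope : ∀ {x} → (ab +ˡ (-ˡ (s *ˡ t))) [ i ℤ.+ j ] + ((s *ˡ t) [ i ℤ.+ j ] + x) ≈ ab [ i ℤ.+ j ] + x
  telescope {x} = begin
    (ab +ˡ (-ˡ (s *ˡ t))) [ i ℤ.+ j ] + (st + x)
      ≈⟨ +-congʳ (trans (at-+ ab (-ˡ (s *ˡ t)) (i ℤ.+ j)) (+-congˡ (at-neg (s *ˡ t) (i ℤ.+ j)))) ⟩
    ab [ i ℤ.+ j ] + - st + (st + x)    ≈⟨ +-assoc _ _ _ ⟩
    ab [ i ℤ.+ j ] + (- st + (st + x))  ≈⟨ +-congˡ (+-assoc _ _ _) ⟨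
    ab [ i ℤ.+ j ] + (- st + st + x)    ≈⟨ +-congˡ (trans (+-congʳ (-‿inverseˡ st)) (+-identityˡ x)) ⟩
    ab [ i ℤ.+ j ] + x                  ∎
    where
    st = (s *ˡ t) [ i ℤ.+ j ]
    open ≈-Reasoning setoid

-- Compatibility of `g` with `≗` is required because the recursion reassembles an exponent as
-- `head n ∷ tail n`, which agrees with `n` only pointwise.
mapTerms-coefficient : {R : RawRing c ℓ} → NonAssociative R → ∀ m →
  let open RawRing R in
  (g : Exponent m → Carrier → Carrier) → (∀ n → g n 0# ≈ 0#) →
  (∀ {n k r s} → n ≗ k → r ≈ s → g n r ≈ g k s) →
  ∀ a n → coefficient R m (mapTerms R m g a) n ≈ g n (coefficient R m a n)
mapTerms-coefficient isR zero g g0 g-cong a n = g-cong (λ ()) (IsNonAssociativeRing.refl isR)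
mapTerms-coefficient {R = R} isR (suc m) g g0 g-cong a n = trans
  (mapTerms-coefficient isNonAssociativeRing m (λ n → mapSeries (λ e → g (e ∷ n))) slice-0# slice-cong a (tail n) (head n))
  (trans (at-slice (tail n) (coefficient (laurent R) m a (tail n)) (head n))
         (g-cong {head n ∷ tail n} {n} (≗-∷ ≡.refl λ _ → ≡.refl) refl))
  where
  open Laurent R isR
  open RawRing R using (0#; _≈_)
  module L = RawRing (laurent R)

  at-slice : ∀ n s e → mapSeries (λ e → g (e ∷ n)) s [ e ] ≈ g (e ∷ n) (s [ e ])
  at-slice n = at-mapSeries (λ e → g (e ∷ n)) (λ e → g0 (e ∷ n))

  slice-0# : ∀ n → mapSeries (λ e → g (e ∷ n)) L.0# L.≈ L.0#
  slice-0# n e = trans (at-slice n L.0# e)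
    (trans (g-cong {e ∷ n} (λ _ → ≡.refl) (at-0# e)) (trans (g0 (e ∷ n)) (sym (at-0# e))))

  slice-cong : ∀ {n k s t} → n ≗ k → s L.≈ t →
               mapSeries (λ e → g (e ∷ n)) s L.≈ mapSeries (λ e → g (e ∷ k)) t
  slice-cong {n} {k} {s} {t} n≗k s≈t e = trans (at-slice n s e)
    (trans (g-cong {e ∷ n} {e ∷ k} (≗-∷ ≡.refl n≗k) (s≈t e)) (sym (at-slice k t e)))

coefficient-term : {R : RawRing c ℓ} → NonAssociative R → ∀ m r {n k} → k ≗ n →
                   RawRing._≈_ R (coefficient R m (term R m r n) k) r
coefficient-term isR zero r k≗n = IsNonAssociativeRing.refl isR
coefficient-term {R = R} isR (suc m) r {n} {k} k≗n = trans
  (coefficient-term isNonAssociativeRing m (power R r (head n)) (k≗n ∘ suc) (head k))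
  (trans (reflexive (≡.cong (at R (power R r (head n))) (k≗n zero))) (at-power r (head n)))
  where
  open Laurent R isR

coefficient-term-≢ : {R : RawRing c ℓ} → NonAssociative R → ∀ m r {n k} → ¬ (k ≗ n) →
                     RawRing._≈_ R (coefficient R m (term R m r n) k) (RawRing.0# R)
coefficient-term-≢ isR zero r k≢n = ⊥-elim (k≢n λ ())
coefficient-term-≢ {R = R} isR (suc m) r {n} {k} k≢n with ≗-dec (tail k) (tail n)
... | no  k≢n′ = trans (coefficient-term-≢ isNonAssociativeRing m (power R r (head n)) k≢n′ (head k)) (at-0# (head k))
  where
  open Laurent R isR
... | yes k≗n′ = trans (coefficient-term isNonAssociativeRing m (power R r (head n)) k≗n′ (head k))
                       (at-power-≢ r (head n) λ k≡n → k≢n (≗-∷ k≡n k≗n′))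
  where
  open Laurent R isR

-- Makes the lemmas on the coefficients of a `term` applicable to `1#`.
1#≡term : (R : RawRing c ℓ) → ∀ m → RawRing.1# (iterated R m) ≡ term R m (RawRing.1# R) (λ _ → 0ℤ)
1#≡term R zero    = ≡.refl
1#≡term R (suc m) = 1#≡term (laurent R) m

-- Existence of the order of a nonzero series

module Lowest {c ℓ : Level} (em : ExcludedMiddle ℓ) where

  least : (P : ℕ → Set ℓ) → ∀ k → P k → ∃[ n ] (P n × ∀ i → P i → n ℕ.≤ i)
  least P k       Pk with em {P = P 0}
  least P k       Pk | yes P0 = 0 , P0 , λ _ _ → ℕ.z≤n
  least P zero    Pk | no ¬P0 = ⊥-elim (¬P0 Pk)
  least P (suc k) Pk | no ¬P0 with least (P ∘ suc) k Pk
  ... | n , Pn , n≤ = suc n , Pn , λ { zero P0 → ⊥-elim (¬P0 P0) ; (suc i) Pi → ℕ.s≤s (n≤ i Pi) }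

  module _ {R : RawRing c ℓ} (isR : NonAssociative R) where
    open RawRing R
    open Laurent R isR

    lowest : ∀ s → ¬ (∀ e → s [ e ] ≈ at R (RawRing.0# (laurent R)) e) →
             ∃[ e ] (¬ (s [ e ] ≈ 0#) × (∀ i → ¬ (s [ i ] ≈ 0#) → e ℤ.≤ i))
    lowest s s≉0 with em {P = ∃[ e ] ¬ (s [ e ] ≈ 0#)}
    ... | no none = ⊥-elim (s≉0 λ e → trans (vanishes e) (sym (at-0# e)))
      where
      vanishes : ∀ e → s [ e ] ≈ 0#
      vanishes e with em {P = s [ e ] ≈ 0#}
      ... | yes ≈0 = ≈0
      ... | no  ≉0 = ⊥-elim (none (e , ≉0))
    ... | yes (e , se≉0) with position (low s) e
    ...   | below e<l = ⊥-elim (se≉0 (reflexive (at-below s e<l)))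
    ...   | offset k with least (λ k → ¬ (s [ low s ℤ.+ + k ] ≈ 0#)) k se≉0
    ...     | n , sn≉0 , n≤ = low s ℤ.+ + n , sn≉0 , minimal
      where
      minimal : ∀ i → ¬ (s [ i ] ≈ 0#) → low s ℤ.+ + n ℤ.≤ i
      minimal i si≉0 with position (low s) i
      ... | below i<l = ⊥-elim (si≉0 (reflexive (at-below s i<l)))
      ... | offset k  = ℤ.+-monoʳ-≤ (low s) (ℤ.+≤+ (n≤ k si≉0))

  -- Later variables have priority in the ordering, so the least tail carrying a nonzero series in
  -- `x₁` is found by induction over `laurent R`, and `lowest` then gives its head. The exponent
  -- passed in only witnesses that the series is nonzero.
  minimum : {R : RawRing c ℓ} → NonAssociative R → ∀ m a n →
    let open RawRing R in
    ¬ (coefficient R m a n ≈ 0#) →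
    ∃[ n ] (¬ (coefficient R m a n ≈ 0#) × (∀ k → ¬ (coefficient R m a k ≈ 0#) → n ≤ʳ k))
  minimum isR zero a n an≉0 = n , an≉0 , λ k _ → inj₂ λ ()
  minimum {R = R} isR (suc m) a n an≉0
    with minimum isNonAssociativeRing m a (tail n) (nonzero n an≉0)
    where
    open RawRing R
    open Laurent R isR
    nonzero : ∀ n → ¬ (coefficient R (suc m) a n ≈ 0#) →
              ¬ (RawRing._≈_ (laurent R) (coefficient (laurent R) m a (tail n)) (RawRing.0# (laurent R)))
    nonzero n an≉0 ≈0 = an≉0 (trans (≈0 (head n)) (at-0# (head n)))
  ... | ns , ans≉0 , ns≤ with lowest isR (coefficient (laurent R) m a ns) ans≉0
  ...   | e , ae≉0 , e≤ = (e ∷ ns) , ae≉0 , λ k ak≉0 →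
    [ (λ ns<k → inj₁ (<ʳ-tail ns<k)) , at-tail k ak≉0 ]′ (ns≤ (tail k) λ ≈0 → ak≉0 (trans (≈0 (head k)) (at-0# (head k))))
    where
    open RawRing R
    open Laurent R isR
    at-tail : ∀ k → ¬ (coefficient R (suc m) a k ≈ 0#) → ns ≗ tail k → (e ∷ ns) ≤ʳ k
    at-tail k ak≉0 ns≗k with ℤ.<-cmp e (head k)
    ... | tri< e<k _ _ = inj₁ (<ʳ-head ns≗k e<k)
    ... | tri≈ _ e≡k _ = inj₂ (≗-∷ e≡k ns≗k)
    ... | tri> _ _ k<e = ⊥-elim (ℤ.<⇒≱ k<e (e≤ (head k) λ ≈0 →
            ak≉0 (trans (coefficient-≗ isNonAssociativeRing m a (≡.sym ∘ ns≗k) (head k)) ≈0)))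

-- Orders and exponents of λ over a field

module Exponents (em : ∀ {a} → ExcludedMiddle a) {c ℓ : Level}
                 (K : CommutativeRing c ℓ) (K-field : IsField K) (m : ℕ) (v : Fin m) where

  private module K = CommutativeRing K

  isK : NonAssociative K.rawRing
  isK = record
    { +-isAbelianGroup = K.+-isAbelianGroup
    ; *-cong           = K.*-cong
    ; *-identity       = K.*-identity
    ; distrib          = K.distrib
    ; zero             = K.zero
    }

  open IteratedLaurent K.rawRing m v
  open Classical em
  open IsNonAssociativeRing (iterated-isNonAssociativeRing isK m) hiding (zero; _-_)
  open Sums K.rawRing isK using (≈0-closed; x-y≈0⇒x≈y)
  open Sums 𝕂 (iterated-isNonAssociativeRing isK m) using (sum∈)
  open RingProperties K.ring using (-0#≈0#; -‿involutive)
  open Lowest {c} (em {ℓ}) using (minimum)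

  infix 9 _!_
  _!_ : Carrier → Exponent m → K.Carrier
  _!_ = coefficient K.rawRing m

  !-cong : ∀ {a b} → a ≈ b → ∀ n → a ! n K.≈ b ! n
  !-cong = coefficient-cong K.rawRing m

  !-ext : ∀ {a b} → (∀ n → a ! n K.≈ b ! n) → a ≈ b
  !-ext = coefficient-ext K.rawRing m

  !-+ : ∀ a b n → (a + b) ! n K.≈ a ! n K.+ b ! n
  !-+ = coefficient-+ isK m

  !-neg : ∀ a n → (- a) ! n K.≈ K.- (a ! n)
  !-neg = coefficient-neg isK m

  !-0# : ∀ n → 0# ! n K.≈ K.0#
  !-0# = coefficient-0# isK m

  -- `coefficient-*∈` sets one factorisation of `N` apart; here it is `N` and the zero exponent, and
  -- its contribution vanishes like the others.
  !-* : ∀ a b N → (∀ n k → n ⊕ k ≗ N → a ! n K.* b ! k K.≈ K.0#) → (a * b) ! N K.≈ K.0#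
  !-* a b N vanish = K.trans (coefficient-≗ isK m (a * b) λ i → ≡.sym (ℤ.+-identityʳ (N i)))
    (K.trans (x-y≈0⇒x≈y (coefficient-*∈ isK m ≈0-closed a b N (λ _ → 0ℤ)
               λ n k sums _ → vanish n k λ i → ≡.trans (sums i) (ℤ.+-identityʳ (N i))))
             (vanish N (λ _ → 0ℤ) λ i → ℤ.+-identityʳ (N i)))

  -- A bound on the exponents of λ in the support. `InL` amounts to the case `_≡ 0ℤ`. Wrapping the
  -- function type in a record lets `S` and `a` be inferred from the type of a proof.
  record ExponentsIn (S : Pred ℤ 0ℓ) (a : Carrier) : Set ℓ where
    constructor exponentsIn
    field outside : ∀ n → ¬ S (n v) → a ! n K.≈ K.0#

  open ExponentsIn

  private variable
    S T W : Pred ℤ 0ℓ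
    a b : Carrier

  exponentsIn-closed : ∀ S → SumClosed 𝕂 (ExponentsIn S)
  exponentsIn-closed S = record
    { resp  = λ a≈b a∈ → exponentsIn λ n n∉ → K.trans (K.sym (!-cong a≈b n)) (outside a∈ n n∉)
    ; zero∈ = exponentsIn λ n _ → !-0# n
    ; plus∈ = λ {a} {b} a∈ b∈ → exponentsIn λ n n∉ → K.trans (!-+ a b n)
        (K.trans (K.+-cong (outside a∈ n n∉) (outside b∈ n n∉)) (K.+-identityˡ K.0#))
    }

  exponentsIn-⊆ : S ⊆ T → ExponentsIn S a → ExponentsIn T a
  exponentsIn-⊆ S⊆T a∈ = exponentsIn λ n n∉ → outside a∈ n (n∉ ∘ S⊆T)

  exponentsIn-neg : ExponentsIn S a → ExponentsIn S (- a)
  exponentsIn-neg {a = a} a∈ = exponentsIn λ n n∉ →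
    K.trans (!-neg a n) (K.trans (K.-‿cong (outside a∈ n n∉)) -0#≈0#)

  exponentsIn-* : (∀ {i j} → S i → T j → W (i ℤ.+ j)) →
                  ExponentsIn S a → ExponentsIn T b → ExponentsIn W (a * b)
  exponentsIn-* {S} {T} {W} {a} {b} S+T⊆W a∈ b∈ = exponentsIn λ N N∉ → !-* a b N (vanish N N∉)
    where
    vanish : ∀ N → ¬ W (N v) → ∀ n k → n ⊕ k ≗ N → a ! n K.* b ! k K.≈ K.0#
    vanish N N∉ n k sums with em {P = S (n v)} | em {P = T (k v)}
    ... | no n∉  | _      = K.trans (K.*-congʳ (outside a∈ n n∉)) (K.zeroˡ _)
    ... | yes _  | no k∉  = K.trans (K.*-congˡ (outside b∈ k k∉)) (K.zeroʳ _)
    ... | yes n∈ | yes k∈ = ⊥-elim (N∉ (≡.subst W (sums v) (S+T⊆W n∈ k∈)))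

  nonzero⇒exponent : ∀ n → ExponentsIn S a → ¬ (a ! n K.≈ K.0#) → S (n v)
  nonzero⇒exponent {S} n a∈ an≉0 with em {P = S (n v)}
  ... | yes n∈ = n∈
  ... | no  n∉ = ⊥-elim (an≉0 (outside a∈ n n∉))

  unit-v : unit v v ≡ 1ℤ
  unit-v with v Fin.≟ v
  ... | yes _  = ≡.refl
  ... | no v≢v = ⊥-elim (v≢v ≡.refl)

  1#-exponents : ExponentsIn (_≡ 0ℤ) 1#
  1#-exponents rewrite 1#≡term K.rawRing m = exponentsIn λ n nv≢0 →
    coefficient-term-≢ isK m K.1# λ n≗0 → nv≢0 (n≗0 v)

  Λ-exponents : ExponentsIn (_≡ 1ℤ) Λ
  Λ-exponents = exponentsIn λ n nv≢1 →
    coefficient-term-≢ isK m K.1# λ n≗unit → nv≢1 (≡.trans (n≗unit v) unit-v)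

  Λ^-exponents : ∀ j → ExponentsIn (_≡ + j) (Λ ^ j)
  Λ^-exponents zero    = 1#-exponents
  Λ^-exponents (suc j) =
    exponentsIn-* (λ { ≡.refl ≡.refl → ≡.refl }) Λ-exponents (Λ^-exponents j)

  InL[Λ]<-exponents : ∀ {d} → (InL[Λ]< d) a → ExponentsIn (λ e → 0ℤ ℤ.≤ e × e ℤ.< + d) a
  InL[Λ]<-exponents {d = d} (q , q∈L , a≈) =
    SumClosed.resp (exponentsIn-closed _) (sym a≈)
      (sum∈ (exponentsIn-closed _)
        (λ i → q i * Λ ^ toℕ i) λ i →
          exponentsIn-* {S = _≡ 0ℤ} {T = _≡ + toℕ i}
            (λ { ≡.refl ≡.refl → ℤ.+≤+ ℕ.z≤n , ℤ.+<+ (Fin.toℕ<n i) }) (exponentsIn (q∈L i)) (Λ^-exponents (toℕ i)))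

  below-order : ∀ {a n k} → IsOrder a n → k <ʳ n → a ! k K.≈ K.0#
  below-order {a} {n} {k} (_ , n≤) k<n with em {P = a ! k K.≈ K.0#}
  ... | yes ≈0 = ≈0
  ... | no  ≉0 = ⊥-elim (<ʳ⇒≱ʳ k<n (n≤ k ≉0))

  -- Any other factorisation of the leading monomial has a factor below its order, by `⊕-<ʳ`. What
  -- remains is the product of the two leading coefficients, nonzero in the field `K`.
  order-* : ∀ {a b n k} → IsOrder a n → IsOrder b k → ¬ ((a * b) ! (n ⊕ k) K.≈ K.0#)
  order-* {a} {b} {n} {k} a-order@(an≉0 , _) b-order@(bk≉0 , _) ≈0 = domain an≉0 bk≉0
      (K.trans (K.sym (x-y≈0⇒x≈y (coefficient-*∈ isK m ≈0-closed a b n k others))) ≈0)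
    where
    domain : ∀ {x y} → ¬ (x K.≈ K.0#) → ¬ (y K.≈ K.0#) → ¬ (x K.* y K.≈ K.0#)
    domain {x} {y} x≉0 y≉0 xy≈0 with IsField.≉0⇒inv K-field x x≉0
    ... | x⁻¹ , x⁻¹x≈1 , _ = y≉0 (K.trans (K.sym (K.*-identityˡ y))
            (K.trans (K.*-congʳ (K.sym x⁻¹x≈1)) (K.trans (K.*-assoc x⁻¹ x y)
              (K.trans (K.*-congˡ xy≈0) (K.zeroʳ x⁻¹)))))

    others : ∀ n′ k′ → n′ ⊕ k′ ≗ n ⊕ k → ¬ (n′ ≗ n) → a ! n′ K.* b ! k′ K.≈ K.0#
    others n′ k′ sums n′≢n with compareʳ n n′
    ... | inj₁ n<n′        = K.trans (K.*-congˡ (below-order b-order (⊕-<ʳ {n = n} {k} {n′} {k′} sums n<n′))) (K.zeroʳ _)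
    ... | inj₂ (inj₁ n≗n′) = ⊥-elim (n′≢n (≡.sym ∘ n≗n′))
    ... | inj₂ (inj₂ n′<n) = K.trans (K.*-congʳ (below-order a-order n′<n)) (K.zeroˡ _)

  order-+ : ∀ {a b n} → IsOrder a n → (∀ k → ¬ (b ! k K.≈ K.0#) → n <ʳ k) → IsOrder (a + b) n
  order-+ {a} {b} {n} a-order@(an≉0 , n≤) n<b =
      (λ ≈0 → an≉0 (K.trans (K.sym (K.+-identityʳ _)) (K.trans (K.+-congˡ (K.sym bn≈0))
                (K.trans (K.sym (!-+ a b n)) ≈0))))
    , minimal
    where
    bn≈0 : b ! n K.≈ K.0#
    bn≈0 with em {P = b ! n K.≈ K.0#}
    ... | yes ≈0 = ≈0
    ... | no  ≉0 = ⊥-elim (<ʳ⇒≱ʳ (n<b n ≉0) (inj₂ λ _ → ≡.refl))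

    minimal : ∀ k → ¬ ((a + b) ! k K.≈ K.0#) → n ≤ʳ k
    minimal k ≉0 with em {P = a ! k K.≈ K.0#}
    ... | no  ak≉0 = n≤ k ak≉0
    ... | yes ak≈0 = inj₁ (n<b k λ bk≈0 → ≉0
            (K.trans (!-+ a b k) (K.trans (K.+-cong ak≈0 bk≈0) (K.+-identityˡ K.0#))))

  neg-nonzero : ∀ a n → ¬ ((- a) ! n K.≈ K.0#) → ¬ (a ! n K.≈ K.0#)
  neg-nonzero a n -an≉0 an≈0 =
    -an≉0 (K.trans (!-neg a n) (K.trans (K.-‿cong an≈0) -0#≈0#))

  order-neg : ∀ {a n} → IsOrder a n → IsOrder (- a) n
  order-neg {a} {n} (an≉0 , n≤) =
      (λ ≈0 → an≉0 (K.trans (K.sym (-‿involutive (a ! n)))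
                (K.trans (K.-‿cong (K.trans (K.sym (!-neg a n)) ≈0)) -0#≈0#)))
    , λ k → n≤ k ∘ neg-nonzero a k

  -- Nonvanishing alone provides an order, and it passes to the next power because leading
  -- coefficients multiply. The exponent of λ in that order can then be read off from
  -- `Λ^-exponents`.
  Λ^-order : ∀ j → ∃[ n ] IsOrder (Λ ^ j) n
  Λ^-order j = minimum isK m (Λ ^ j) (proj₁ (nonzero j)) (proj₂ (nonzero j))
    where
    nonzero : ∀ j → ∃[ n ] ¬ ((Λ ^ j) ! n K.≈ K.0#)
    nonzero zero = (λ _ → 0ℤ) , λ ≈0 → IsField.1≉0 K-field
      (K.trans (K.sym (coefficient-term isK m K.1# λ _ → ≡.refl))
        (≡.subst (λ a → a ! (λ _ → 0ℤ) K.≈ K.0#) (1#≡term K.rawRing m) ≈0))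
    nonzero (suc j) = _ , order-* (proj₂ Λ-order) (proj₂ (Λ^-order j))
      where
      Λ-order : ∃[ n ] IsOrder Λ n
      Λ-order = minimum isK m Λ (unit v) λ ≈0 → IsField.1≉0 K-field
        (K.trans (K.sym (coefficient-term isK m K.1# λ _ → ≡.refl)) ≈0)

  -- `PT` is `keep (0ℤ ℤ.≤?_)` by definition. A general `S` makes the same lemmas serve for cutting
  -- the inverse of a denominator in two.
  keep : Decidable S → Carrier → Carrier
  keep S? = mapTerms K.rawRing m λ n r → if does (S? (n v)) then r else K.0#

  keep-! : (S? : Decidable S) → ∀ a n → keep S? a ! n K.≈ (if does (S? (n v)) then a ! n else K.0#)
  keep-! {S} S? = mapTerms-coefficient isK m select preserves-0# (λ {n} {k} → respects {n} {k})
    where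
    select : Exponent m → K.Carrier → K.Carrier
    select n r = if does (S? (n v)) then r else K.0#

    preserves-0# : ∀ n → select n K.0# K.≈ K.0#
    preserves-0# n with S? (n v)
    ... | yes _ = K.refl
    ... | no  _ = K.refl

    respects : ∀ {n k : Exponent m} {r s} → n ≗ k → r K.≈ s →
               select n r K.≈ select k s
    respects {n} {k} n≗k r≈s rewrite n≗k v with S? (k v)
    ... | yes _ = r≈s
    ... | no  _ = K.refl

  keep-∈ : (S? : Decidable S) → ∀ a n → S (n v) → keep S? a ! n K.≈ a ! n
  keep-∈ S? a n n∈ with S? (n v) | keep-! S? a n
  ... | yes _  | eq = eq
  ... | no  n∉ | _  = ⊥-elim (n∉ n∈)

  keep-exponents : (S? : Decidable S) → ∀ a → ExponentsIn S (keep S? a)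
  keep-exponents {S} S? a = exponentsIn vanish
    where
    vanish : ∀ n → ¬ S (n v) → keep S? a ! n K.≈ K.0#
    vanish n n∉ with S? (n v) | keep-! S? a n
    ... | yes n∈ | _  = ⊥-elim (n∉ n∈)
    ... | no  _  | eq = eq

  keep-id : (S? : Decidable S) → ExponentsIn S a → keep S? a ≈ a
  keep-id {a = a} S? a∈ = !-ext λ n → keep-at n
    where
    keep-at : ∀ n → keep S? a ! n K.≈ a ! n
    keep-at n with S? (n v)
    ... | yes n∈ = keep-∈ S? a n n∈
    ... | no  n∉ = K.trans (outside (keep-exponents S? a) n n∉) (K.sym (outside a∈ n n∉))

  keep-0# : (S? : Decidable S) → ExponentsIn (∁ S) a → keep S? a ≈ 0#
  keep-0# {a = a} S? a∉ = !-ext λ n → K.trans (keep-at n) (K.sym (!-0# n))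
    where
    keep-at : ∀ n → keep S? a ! n K.≈ K.0#
    keep-at n with S? (n v)
    ... | yes n∈ = K.trans (keep-∈ S? a n n∈) (outside a∉ n λ n∉ → n∉ n∈)
    ... | no  n∉ = outside (keep-exponents S? a) n n∉

  keep-cong : (S? : Decidable S) → a ≈ b → keep S? a ≈ keep S? b
  keep-cong {a = a} {b = b} S? a≈b = !-ext keep-at
    where
    keep-at : ∀ n → keep S? a ! n K.≈ keep S? b ! n
    keep-at n with S? (n v)
    ... | yes n∈ = K.trans (keep-∈ S? a n n∈) (K.trans (!-cong a≈b n) (K.sym (keep-∈ S? b n n∈)))
    ... | no  n∉ = K.trans (outside (keep-exponents S? a) n n∉) (K.sym (outside (keep-exponents S? b) n n∉))

  keep-+ : (S? : Decidable S) → ∀ a b → keep S? (a + b) ≈ keep S? a + keep S? b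
  keep-+ S? a b = !-ext λ n → K.trans (keep-at n) (K.sym (!-+ (keep S? a) (keep S? b) n))
    where
    keep-at : ∀ n → keep S? (a + b) ! n K.≈ keep S? a ! n K.+ keep S? b ! n
    keep-at n with S? (n v)
    ... | yes n∈ = K.trans (keep-∈ S? (a + b) n n∈) (K.trans (!-+ a b n)
                     (K.sym (K.+-cong (keep-∈ S? a n n∈) (keep-∈ S? b n n∈))))
    ... | no  n∉ = K.trans (outside (keep-exponents S? (a + b)) n n∉) (K.sym (K.trans
                     (K.+-cong (outside (keep-exponents S? a) n n∉) (outside (keep-exponents S? b) n n∉)) (K.+-identityˡ K.0#)))

  keep-sum : (S? : Decidable S) → ∀ {n} (t : Fin n → Carrier) → keep S? (sum t) ≈ sum (keep S? ∘ t)
  keep-sum S? {zero}  t = keep-0# S? (exponentsIn λ n _ → !-0# n)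
  keep-sum S? {suc n} t = trans (keep-+ S? (t zero) (sum (t ∘ suc))) (+-congˡ (keep-sum S? (t ∘ suc)))

  keep-split : (S? : Decidable S) → ∀ a → a ≈ keep S? a + keep (¬? ∘ S?) a
  keep-split S? a = !-ext λ n → K.sym (K.trans (!-+ (keep S? a) (keep (¬? ∘ S?) a) n) (keep-at n))
    where
    keep-at : ∀ n → keep S? a ! n K.+ keep (¬? ∘ S?) a ! n K.≈ a ! n
    keep-at n with S? (n v)
    ... | yes n∈ = K.trans (K.+-cong (keep-∈ S? a n n∈) (outside (keep-exponents (¬? ∘ S?) a) n λ n∉ → n∉ n∈)) (K.+-identityʳ _)
    ... | no  n∉ = K.trans (K.+-cong (outside (keep-exponents S? a) n n∉) (keep-∈ (¬? ∘ S?) a n n∉)) (K.+-identityˡ _)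

  -- Here `S` is the set of forbidden exponents. With `u` cut into `u₀` and `u₁` by `S`, `separated`
  -- keeps the exponent of λ of the leading monomial of `D * u₀` out of `D * u₁`, and `nonzero`
  -- keeps it out of `1#`. By distributivity its coefficient in `D * u₀` would be 0, against
  -- `order-*`.
  inverse-exponents : (S? : Decidable S) → ∀ {D u δ} → D * u ≈ 1# → IsOrder D δ → ExponentsIn T D →
    (∀ {i j k} → T i → ¬ S j → S k → i ℤ.+ j ≢ δ v ℤ.+ k) → (∀ {k} → S k → δ v ℤ.+ k ≢ 0ℤ) →
    ExponentsIn (∁ S) u
  inverse-exponents {S} S? {D} {u} {δ} Du≈1 D-order D∈ separated nonzero = exponentsIn vanish
   where
   vanish : ∀ n → ¬ ∁ S (n v) → u ! n K.≈ K.0#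
   vanish n ¬¬n∈
     with S? (n v) | em {P = u ! n K.≈ K.0#}
   ... | no n∉  | _ = ⊥-elim (¬¬n∈ n∉)
   ... | yes _  | yes un≈0 = un≈0
   ... | yes n∈ | no  un≉0
     with minimum isK m (keep S? u) n (un≉0 ∘ K.trans (K.sym (keep-∈ S? u n n∈)))
   ...   | n₀ , u₀-order = ⊥-elim (order-* D-order u₀-order (begin
     (D * u₀) ! N                     ≈⟨ K.+-identityʳ _ ⟨
     (D * u₀) ! N K.+ K.0#            ≈⟨ K.+-congˡ Du₁≈0 ⟨
     (D * u₀) ! N K.+ (D * u₁) ! N    ≈⟨ !-+ (D * u₀) (D * u₁) N ⟨
     (D * u₀ + D * u₁) ! N            ≈⟨ !-cong (distribˡ D u₀ u₁) N ⟨
     (D * (u₀ + u₁)) ! N              ≈⟨ !-cong (*-congˡ (keep-split S? u)) N ⟨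
     (D * u) ! N                      ≈⟨ !-cong Du≈1 N ⟩
     1# ! N                           ≈⟨ outside 1#-exponents N (nonzero n₀∈) ⟩
     K.0#                             ∎))
     where
     open ≈-Reasoning K.setoid
     N = δ ⊕ n₀
     u₀ = keep S? u
     u₁ = keep (¬? ∘ S?) u

     n₀∈ : S (n₀ v)
     n₀∈ = nonzero⇒exponent n₀ (keep-exponents S? u) (proj₁ u₀-order)

     Du₁≈0 : (D * u₁) ! N K.≈ K.0#
     -- `W` omits just the exponent of λ in `N`, so having exponents in `W` entails vanishing at
     -- `N`.
     Du₁≈0 = outside (exponentsIn-* {W = λ e → e ≢ δ v ℤ.+ n₀ v} (λ i∈ j∉ → separated i∈ j∉ n₀∈)
       D∈ (keep-exponents (¬? ∘ S?) u)) N λ N≢N → N≢N ≡.refl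

  -- Inverses and the fractions of the decomposition

  ⁻¹-inverse : ∀ a → a ⁻¹ ≡ 0# ⊎ a * a ⁻¹ ≈ 1#
  ⁻¹-inverse a with em {P = Invertible _≈_ 1# _*_ a}
  ... | yes (_ , _ , aa⁻¹≈1) = inj₂ aa⁻¹≈1
  ... | no  _                = inj₁ ≡.refl

  -- The default value `0#` of `_⁻¹` has empty support and satisfies every bound, so only a genuine
  -- inverse has to be examined.
  ⁻¹-exponents : (a * a ⁻¹ ≈ 1# → ExponentsIn S (a ⁻¹)) → ExponentsIn S (a ⁻¹)
  ⁻¹-exponents {a} {S} inverse with ⁻¹-inverse a
  ... | inj₂ aa⁻¹≈1 = inverse aa⁻¹≈1
  ... | inj₁ a⁻¹≡0  = ≡.subst (ExponentsIn S) (≡.sym a⁻¹≡0) (exponentsIn λ n _ → !-0# n)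

  module _ (j : ℕ) {z p : Carrier} (z∈L : InL z) (p∈ : (InL[Λ]< j) p) where

    D = Λ ^ j - z

    z∈ : ExponentsIn (_≡ 0ℤ) z
    z∈ = exponentsIn z∈L

    D-exponents : ExponentsIn (λ e → 0ℤ ℤ.≤ e × e ℤ.≤ + j) D
    D-exponents = SumClosed.plus∈ (exponentsIn-closed _)
      (exponentsIn-⊆ (λ { ≡.refl → ℤ.+≤+ ℕ.z≤n , ℤ.≤-refl }) (Λ^-exponents j))
      (exponentsIn-⊆ (λ { ≡.refl → ℤ.≤-refl , ℤ.+≤+ ℕ.z≤n }) (exponentsIn-neg z∈))

    -- The order of `D` is that of `z`, with exponent 0 of λ, the least possible in `D`. Its leading
    -- monomial thus leaves negative exponents of λ negative, while `D` leaves nonnegative ones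
    -- nonnegative; so `D ⁻¹` has no negative exponents, and neither does `p`.
    fraction-≥0 : z ≺ Λ ^ j → ExponentsIn (0ℤ ℤ.≤_) (p / D)
    fraction-≥0 (n , z-order , z≺) =
      exponentsIn-* (λ (0≤i , _) j≮0 → ℤ.+-mono-≤ 0≤i (ℤ.≮⇒≥ j≮0)) (InL[Λ]<-exponents p∈)
        (⁻¹-exponents λ DD⁻¹≈1 → inverse-exponents (ℤ._<? 0ℤ) DD⁻¹≈1 D-order D-exponents
          (λ (0≤i , _) k≮0 l<0 eq → ℤ.<⇒≱ (≡.subst (ℤ._< 0ℤ) (≡.sym (nv+ _)) l<0)
             (≡.subst (0ℤ ℤ.≤_) eq (ℤ.+-mono-≤ 0≤i (ℤ.≮⇒≥ k≮0))))
          (λ l<0 eq → ℤ.<-irrefl (≡.trans (≡.sym (nv+ _)) eq) l<0))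
      where
      nv+ : ∀ k → n v ℤ.+ k ≡ k
      nv+ k = ≡.trans (≡.cong (ℤ._+ k) (nonzero⇒exponent n z∈ (proj₁ z-order))) (ℤ.+-identityˡ k)

      n<Λ^j : (Λ ^ j ≈ 0# ⊎ ∃[ k ] (IsOrder (Λ ^ j) k × n <ʳ k)) →
              ∀ k → ¬ ((Λ ^ j) ! k K.≈ K.0#) → n <ʳ k
      n<Λ^j (inj₁ Λ^j≈0) k ≉0 = ⊥-elim (≉0 (K.trans (!-cong Λ^j≈0 k) (!-0# k)))
      n<Λ^j (inj₂ (l , (_ , l≤) , n<l)) k ≉0 = <ʳ-≤ʳ-trans n<l (l≤ k ≉0)

      D-order : IsOrder D n
      -- `order-+` expects the dominant summand on the left, here `- z`.
      D-order = order-resp (+-comm (- z) (Λ ^ j)) (order-+ (order-neg z-order) (n<Λ^j z≺))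
        where
        order-resp : ∀ {a b n} → a ≈ b → IsOrder a n → IsOrder b n
        order-resp {n = n} a≈b (an≉0 , n≤) = (λ ≈0 → an≉0 (K.trans (!-cong a≈b n) ≈0))
          , λ k ≉0 → n≤ k λ ≈0 → ≉0 (K.trans (K.sym (!-cong a≈b k)) ≈0)

    -- The order of `D` is that of `Λ ^ j`, with exponent `j` of λ, the greatest possible in `D`.
    -- Exponents above `-j` are therefore sent above 0 by the leading monomial, and the others to at
    -- most 0 by all of `D`. So `D ⁻¹` has exponents at most `-j`; since those of `p` stay strictly
    -- below `j`, the sums are negative.
    fraction-<0 : 0 ℕ.< j → ¬ (z ≺ Λ ^ j) → ExponentsIn (∁ (0ℤ ℤ.≤_)) (p / D)
    fraction-<0 0<j z⊀ =
      exponentsIn-* (λ {i} {k} (_ , i<j) k≯-j → ℤ.<⇒≱ (≡.subst (i ℤ.+ k ℤ.<_) (ℤ.+-inverseʳ (+ j))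
                       (ℤ.+-mono-<-≤ i<j (ℤ.≮⇒≥ k≯-j)))) (InL[Λ]<-exponents p∈)
        (⁻¹-exponents λ DD⁻¹≈1 → inverse-exponents (ℤ.- (+ j) ℤ.<?_) DD⁻¹≈1 D-order D-exponents
          (λ {i} {k} {l} (_ , i≤j) k≯-j -j<l eq → ℤ.<⇒≱ (positive -j<l) (≡.subst (ℤ._≤ 0ℤ) eq
             (≡.subst (i ℤ.+ k ℤ.≤_) (ℤ.+-inverseʳ (+ j)) (ℤ.+-mono-≤ i≤j (ℤ.≮⇒≥ k≯-j)))))
          (λ -j<l eq → ℤ.<-irrefl (≡.sym eq) (positive -j<l)))
      where
      κ = proj₁ (Λ^-order j)
      κ-order = proj₂ (Λ^-order j)

      κv≡j : κ v ≡ + j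
      κv≡j = nonzero⇒exponent κ (Λ^-exponents j) (proj₁ κ-order)

      positive : ∀ {l} → ℤ.- (+ j) ℤ.< l → 0ℤ ℤ.< κ v ℤ.+ l
      positive {l} -j<l = ≡.subst₂ ℤ._<_ (ℤ.+-inverseʳ (+ j)) (≡.cong (ℤ._+ l) (≡.sym κv≡j))
                            (ℤ.+-monoʳ-< (+ j) -j<l)

      -- Vacuous if `z` is 0; otherwise a nonzero coefficient of `z` supplies its order `n`, which
      -- is compared with `κ`.
      κ<z : ∀ k → ¬ ((- z) ! k K.≈ K.0#) → κ <ʳ k
      κ<z k -zk≉0 with minimum isK m z k (neg-nonzero z k -zk≉0)
      ... | n , z-order@(zn≉0 , n≤) with compareʳ n κ
      ...   | inj₁ n<κ        = ⊥-elim (z⊀ (n , z-order , inj₂ (κ , κ-order , n<κ)))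
      -- The exponents of λ in the two orders are 0 and `j`, which differ as `j` is positive.
      ...   | inj₂ (inj₁ n≗κ) = ⊥-elim (ℕ.<-irrefl (ℤ.+-injective (≡.trans
                (≡.sym (nonzero⇒exponent n z∈ zn≉0)) (≡.trans (n≗κ v) κv≡j))) 0<j)
      ...   | inj₂ (inj₂ κ<n) = <ʳ-≤ʳ-trans κ<n (n≤ k (neg-nonzero z k -zk≉0))

      D-order : IsOrder D κ
      D-order = order-+ κ-order κ<z

  -- The exponent `j = 0` is set apart: `z` and `Λ ^ 0` may then have the same order, so that
  -- neither dominates in `D`.
  PT-fraction : ∀ j {z p} → InL z → (InL[Λ]< j) p →
                let t = p / (Λ ^ j - z) in
                PT t ≈ (if does (em {P = z ≺ Λ ^ j}) then t else 0#)
  -- This is the instance of `em` on which `sumOver` branches, so the conditional on the right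
  -- reduces in each case.
  PT-fraction j {z} z∈L p∈ with em {P = z ≺ Λ ^ j}
  PT-fraction j       z∈L p∈ | yes z≺ = keep-id (0ℤ ℤ.≤?_) (fraction-≥0 j z∈L p∈ z≺)
  PT-fraction (suc j) z∈L p∈ | no z⊀  =
    keep-0# (0ℤ ℤ.≤?_) (fraction-<0 (suc j) z∈L p∈ (ℕ.s≤s ℕ.z≤n) z⊀)
  PT-fraction zero    z∈L p∈ | no _   =
    -- p = 0
    keep-0# (0ℤ ℤ.≤?_) (exponentsIn-* {T = U} (λ { (0≤i , i<0) _ → ⊥-elim (ℤ.<⇒≱ i<0 0≤i) })
      (InL[Λ]<-exponents p∈) (exponentsIn λ _ n∉ → ⊥-elim (n∉ _)))

-- Termwise evaluation of `PT` on the decomposition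

mainTheorem14 : (em : ∀ {a} → ExcludedMiddle a) →
    ∀ {c ℓ} (K : CommutativeRing c ℓ) → IsField K → CharacteristicZero K →
    (m : ℕ) (v : Fin m) →
    let open IteratedLaurent (CommutativeRing.rawRing K) m v
        open Classical em
    in
    (P : Carrier) → InL[Λ] P →
    (n : ℕ) (j : Fin n → ℕ) (z : Fin n → Carrier) →
    (∀ i → InL (z i)) →
    (∀ i → ¬ (Λ ^ j i - z i ≈ 0#)) →
    (∀ i k → i ≢ k → CoprimeL[Λ] (Λ ^ j i - z i) (Λ ^ j k - z k)) →
    let F = P / product (λ i → Λ ^ j i - z i) in
    (f : Carrier) → InL[Λ] f →
    (p : Fin n → Carrier) → (∀ i → (InL[Λ]< j i) (p i)) →
    F ≈ f + sum (λ i → p i / (Λ ^ j i - z i)) →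
    PT F ≈ f + sumOver (λ i → z i ≺ Λ ^ j i) (λ i → p i / (Λ ^ j i - z i))
mainTheorem14 em K K-field _ m v P _ n j z z∈L _ _ f (d , f∈) p p∈ F≈ = begin
  PT F                         ≈⟨ keep-cong (0ℤ ℤ.≤?_) F≈ ⟩
  PT (f + sum t)               ≈⟨ keep-+ (0ℤ ℤ.≤?_) f (sum t) ⟩
  PT f + PT (sum t)            ≈⟨ +-cong (keep-id (0ℤ ℤ.≤?_) (exponentsIn-⊆ proj₁ (InL[Λ]<-exponents f∈)))
                                         (keep-sum (0ℤ ℤ.≤?_) t) ⟩
  -- `sumOver` unfolds to a `sum` of conditionals, the right-hand sides of `PT-fraction`.
  f + sum (PT ∘ t)             ≈⟨ +-congˡ (sum-cong λ i → PT-fraction (j i) (z∈L i) (p∈ i)) ⟩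
  f + sumOver (λ i → z i ≺ Λ ^ j i) t ∎
  where
  open Exponents em K K-field m v
  open IteratedLaurent (CommutativeRing.rawRing K) m v
  open Classical em
  open IsNonAssociativeRing (iterated-isNonAssociativeRing isK m) hiding (zero; _-_)
  open ≈-Reasoning setoid
  F = P / product (λ i → Λ ^ j i - z i)
  t : Fin n → Carrier
  t i = p i / (Λ ^ j i - z i)
  sum-cong : ∀ {n} {s t : Fin n → Carrier} → (∀ i → s i ≈ t i) → sum s ≈ sum t
  sum-cong {zero}  s≈t = refl
  sum-cong {suc n} s≈t = +-cong (s≈t zero) (sum-cong (s≈t ∘ suc))
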